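{- Let $P_4$ denote the path with $4$ edges. If $n$ is divisible by $8$, then $\mathrm{ex}^*(n,P_4)=2n$. In general, $\mathrm{ex}^*(n,P_4)=2n+O(1)$.
   Context: $\mathrm{ex}^*(n,F)$ (the rainbow Turán number) is the maximum number of edges in an $n$-vertex graph that admits a proper edge-coloring containing no rainbow copy of $F$, i.e. no copy of $F$ all of whose edges receive different colors. -}

module Defs where

open import Data.Nat using (ℕ; _+_; _≤_; _<ᵇ_)
open import Data.Bool using (Bool; true; false; if_then_else_; _∧_)
open import Data.Fin using (Fin; toℕ; inject₁; suc)
open import Data.List using (List; map; allFin)
open import Data.Nat.ListAction using (sum)
open import Data.Empty using (⊥)
open import Data.Product using (Σ; _×_; ∃-syntax)
open import Relation.Binary.PropositionalEquality using (_≡_; _≢_)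
open import Function.Definitions using (Injective)

record Graph (n : ℕ) : Set where
  field
    adj   : Fin n → Fin n → Bool
    sym   : ∀ u v → adj u v ≡ adj v u
    irrefl : ∀ u → adj u u ≡ false
open Graph public

edgeCount : ∀ {n} → Graph n → ℕ
edgeCount {n} G =
  sum (map (λ i → sum (map (λ j → if (toℕ i <ᵇ toℕ j) ∧ adj G i j then 1 else 0)
                           (allFin n)))
           (allFin n))

record ProperColouring {n : ℕ} (G : Graph n) : Set where
  field
    col    : Fin n → Fin n → ℕ
    colSym : ∀ u v → col u v ≡ col v u
    proper : ∀ u v w → adj G u v ≡ true → adj G u w ≡ true → v ≢ w →
             col u v ≢ col u w
open ProperColouring public

RainbowP4 : ∀ {n} (G : Graph n) → ProperColouring G → Set
RainbowP4 {n} G c =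
  Σ (Fin 5 → Fin n) λ f →
    Injective _≡_ _≡_ f ×
    (∀ (i : Fin 4) → adj G (f (inject₁ i)) (f (suc i)) ≡ true) ×
    Injective _≡_ _≡_ (λ (i : Fin 4) → col c (f (inject₁ i)) (f (suc i)))

Achievable : ℕ → ℕ → Set
Achievable n m =
  ∃[ G ] (edgeCount {n} G ≡ m × ∃[ c ] (RainbowP4 G c → ⊥))

IsRainbowTuranP4 : ℕ → ℕ → Set
IsRainbowTuranP4 n m = Achievable n m × (∀ m' → Achievable n m' → m' ≤ m)

module Submission where

-- Upper bound: deleting a vertex of degree at most 2 loses at most two edges, so one may assume
-- minimum degree at least 3; if moreover all degrees are at most 4, there are at most 2n edges.
-- So it suffices that minimum degree 3 and a vertex v of degree at least 5 force a rainbow P₄.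
-- First suppose there is a path w y x v of three edges with distinct colours. It cannot be
-- prolonged at v, which forces the neighbourhood of v to be {x, y, w, p, q} with vp coloured like
-- wy and vq like yx, and the remaining edges are then determined up to a contradiction. If there
-- is no such path, the colours near v are those of copies of K₄ sharing v, and a rainbow P₄ runs
-- through two of them.
-- Lower bound: disjoint copies of K₄,₄ coloured by (ℤ/2)², and isolated vertices.
-- The extremal number exists constructively because being achievable is decidable.

open import Defs
open import Data.Nat using (ℕ; _+_; _*_; _≤_)
open import Data.Nat.Divisibility using (_∣_)
open import Data.Product using (_×_; ∃-syntax)
open import Data.Bool using (Bool; true; false; not; _∧_; _xor_; if_then_else_)
open import Data.Bool.Properties using (T-≡; ¬-not; xor-comm; xor-same) renaming (_≟_ to _≟ᵇ_)
open import Data.Empty using (⊥; ⊥-elim)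
open import Data.Fin
  using (Fin; zero; suc; toℕ; inject₁; punchIn; splitAt; join; _↑ˡ_; _↑ʳ_; combine; remQuot; finToFun; funToFin; _≟_)
open import Data.Fin.Induction using (<-weakInduction)
open import Data.Fin.Patterns using (0F; 1F; 2F; 3F; 4F)
open import Data.Fin.Properties
  using (any?; all?; toℕ-injective; punchIn-injective; join-splitAt; splitAt-↑ˡ; splitAt-↑ʳ; remQuot-combine; finToFun-funToFin)
  renaming (suc-injective to Fin-suc-injective)
open import Data.List using (List; []; _∷_; length; map; tabulate)
open import Data.List.Relation.Unary.All using (All; []; _∷_)
open import Data.Nat using (zero; suc; _<_; _<ᵇ_; _≤?_; _/_; _%_; z≤n; s≤s; s≤s⁻¹)
open import Data.Nat.Divisibility using (divides)
open import Data.Nat.DivMod using (m≡m%n+[m/n]*n; m%n<n)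
import Data.Nat.ListAction as List
open import Data.Nat.Properties
  using ( +-0-commutativeMonoid; ≤-trans; ≤-reflexive; ≤∧≢⇒<; ≰⇒>; <-cmp; <⇒<ᵇ; <ᵇ⇒<; m≤m+n
        ; +-comm; +-assoc; +-identityʳ; +-mono-≤; +-monoˡ-≤
        ; *-comm; *-assoc; *-distribˡ-+; *-monoʳ-≤; *-cancelˡ-≡; *-cancelˡ-≤; module ≤-Reasoning )
  renaming (_≟_ to _≟ⁿ_)
open import Data.Product using (∃; _,_; proj₁; proj₂)
open import Data.Sum using (_⊎_; inj₁; inj₂)
open import Data.Unit using (⊤)
open import Data.Vec using (Vec; []; _∷_; lookup)
open import Data.Vec.Relation.Unary.All using ([]; _∷_)
open import Data.Vec.Relation.Unary.AllPairs using ([]; _∷_)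
open import Data.Vec.Relation.Unary.Unique.Propositional.Properties using (lookup-injective)
open import Function using (_∘_; _$_; id; Equivalence)
open import Function.Definitions using (Injective)
open import Relation.Binary.Definitions using (DecidableEquality; tri<; tri≈; tri>)
open import Relation.Binary.PropositionalEquality
  using (_≡_; _≢_; refl; trans; cong; cong₂; subst; subst₂; ≢-sym; module ≡-Reasoning)
  renaming (sym to ≡-sym)
open import Relation.Nullary using (¬_; Dec; yes; no; ⌊_⌋; contradiction)
open import Relation.Nullary.Decidable using (decidable-stable; map′; toWitness; _×-dec_; _→-dec_; ¬?)
open import Relation.Unary using (Decidable)

open import Algebra.Properties.CommutativeMonoid.Sum +-0-commutativeMonoid

-- Counting and choosing elements of a finite set

bit : Bool → ℕ
bit b = if b then 1 else 0

count : ∀ {n} → (Fin n → Bool) → ℕ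
count p = sum (bit ∘ p)

sum-≤-const : ∀ {n} {f : Fin n → ℕ} k → (∀ i → f i ≤ k) → sum f ≤ n * k
sum-≤-const {zero}  k f≤k = z≤n
sum-≤-const {suc n} k f≤k = +-mono-≤ (f≤k zero) (sum-≤-const k (f≤k ∘ suc))

count-witness : ∀ {n} (p : Fin n → Bool) → 0 < count p → ∃ λ u → p u ≡ true
count-witness {suc n} p 0<c with p zero in eq
... | true  = zero , eq
... | false = let u , pu = count-witness (p ∘ suc) 0<c in suc u , pu

count-none : ∀ {n} (p : Fin n → Bool) → (∀ u → p u ≡ false) → count p ≡ 0
count-none {n} p none = trans (sum-cong-≗ (cong bit ∘ none)) (sum-replicate-zero n)

count-≤1 : ∀ {n} (p : Fin n → Bool) → (∀ {u v} → p u ≡ true → p v ≡ true → u ≡ v) → count p ≤ 1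
count-≤1 {zero}  p unique = z≤n
count-≤1 {suc n} p unique with p zero in eq
... | false = count-≤1 (p ∘ suc) (λ pu pv → Fin-suc-injective (unique pu pv))
... | true  = ≤-reflexive (cong suc (count-none (p ∘ suc) others))
  where
  others : ∀ u → p (suc u) ≡ false
  others u with p (suc u) in eq′
  ... | false = refl
  ... | true  with () ← unique eq eq′

bit-split : ∀ a b → bit a ≡ bit (a ∧ b) + bit (a ∧ not b)
bit-split false _     = refl
bit-split true  true  = refl
bit-split true  false = refl

∧-true : ∀ {a b} → a ∧ b ≡ true → a ≡ true × b ≡ true
∧-true {true} {true} refl = refl , refl

module _ {n} {O : Set} {Q : O → Fin n → Set} (Q? : ∀ o → Decidable (Q o)) where

  -- Greedy choice: discarding what meets the first obstacle costs at most one element of `p`, so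
  -- the count still exceeds the number of obstacles left.
  count-avoid : ∀ (p : Fin n → Bool) (obstacles : List O) →
    All (λ o → ∀ {u v} → p u ≡ true → p v ≡ true → Q o u → Q o v → u ≡ v) obstacles →
    length obstacles < count p →
    ∃ λ u → p u ≡ true × All (λ o → ¬ Q o u) obstacles
  count-avoid p []       []             lt with u , pu ← count-witness p lt = u , pu , []
  count-avoid p (o ∷ os) (single ∷ rest) lt =
    let u , p′u , avoid = count-avoid p′ os (weaken rest) lt′
        pu , q = ∧-true p′u
    in u , pu , not-⌊⌋ (Q? o u) q ∷ avoid
    where
    q : Fin n → Bool
    q u = ⌊ Q? o u ⌋
    p′ : Fin n → Bool
    p′ u = p u ∧ not (q u)
    ⌊⌋-true : ∀ {A : Set} (a? : Dec A) → ⌊ a? ⌋ ≡ true → A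
    ⌊⌋-true (yes a) _ = a
    not-⌊⌋ : ∀ {A : Set} (a? : Dec A) → not ⌊ a? ⌋ ≡ true → ¬ A
    not-⌊⌋ (no ¬a) _ = ¬a
    weaken : ∀ {os} →
      All (λ o → ∀ {u v} → p u ≡ true → p v ≡ true → Q o u → Q o v → u ≡ v) os →
      All (λ o → ∀ {u v} → p′ u ≡ true → p′ v ≡ true → Q o u → Q o v → u ≡ v) os
    weaken []       = []
    weaken (x ∷ xs) = (λ pu pv → x (proj₁ (∧-true pu)) (proj₁ (∧-true pv))) ∷ weaken xs
    split : count p ≡ count (λ u → p u ∧ q u) + count p′
    split = trans (sum-cong-≗ (λ u → bit-split (p u) (q u))) (∑-distrib-+ (λ u → bit (p u ∧ q u)) (bit ∘ p′))
    few : count (λ u → p u ∧ q u) ≤ 1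
    few = count-≤1 _ λ {u} {v} pqu pqv →
      let pu , qu = ∧-true pqu
          pv , qv = ∧-true pqv
      in single pu pv (⌊⌋-true (Q? o u) qu) (⌊⌋-true (Q? o v) qv)
    lt′ : length os < count p′
    lt′ = s≤s⁻¹ (≤-trans lt (≤-trans (≤-reflexive split) (+-monoˡ-≤ (count p′) few)))

-- Coloured edges and rainbow paths

degree : ∀ {n} → Graph n → Fin n → ℕ
degree G v = count (adj G v)

degreeSum : ∀ {n} → Graph n → ℕ
degreeSum G = sum (degree G)

RainbowFree : ∀ {n} (G : Graph n) → ProperColouring G → Set
RainbowFree G c = RainbowP4 G c → ⊥

data Obstacle (n : ℕ) : Set where
  vertex : Fin n → Obstacle n
  colour : ℕ → Obstacle n

module ColouredEdges {n} (G : Graph n) (c : ProperColouring G) where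

  -- The colour is an index, so equations between colours are eliminated by matching on `refl`.
  Edge : Fin n → ℕ → Fin n → Set
  Edge u k v = adj G u v ≡ true × col c u v ≡ k

  edge-sym : ∀ {u k v} → Edge u k v → Edge v k u
  edge-sym {u} {k} {v} (e , eq) = trans (sym G v u) e , trans (colSym c v u) eq

  edge-≢ : ∀ {u k v} → Edge u k v → u ≢ v
  edge-≢ {u} (e , _) refl with () ← trans (≡-sym e) (irrefl G u)

  not-end : ∀ {u k v w} → Edge u k v → (∀ {l} → ¬ Edge u l w) → w ≢ v
  not-end e ¬e refl = ¬e e

  same-end : ∀ {u k v w} → Edge u k v → Edge u k w → v ≡ w
  same-end {u} {k} {v} {w} (e , eq) (e′ , eq′) =
    decidable-stable (v ≟ w) λ v≢w → proper c u v w e e′ v≢w (trans eq (≡-sym eq′))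

  same-colour : ∀ {u k l v} → Edge u k v → Edge u l v → k ≡ l
  same-colour (_ , eq) (_ , eq′) = trans (≡-sym eq) eq′

  colours-≢ : ∀ {u k l v w} → Edge u k v → Edge u l w → v ≢ w → k ≢ l
  colours-≢ e e′ v≢w refl = v≢w (same-end e e′)

  adjacent? : ∀ u v → Dec (∃ λ k → Edge u k v)
  adjacent? u v = map′ (λ e → col c u v , e , refl) (λ (_ , e , _) → e) (adj G u v ≟ᵇ true)

  Hits : Fin n → Obstacle n → Fin n → Set
  Hits v (vertex w) u = u ≡ w
  Hits v (colour k) u = col c v u ≡ k

  hits? : ∀ v o → Decidable (Hits v o)
  hits? v (vertex w) u = u ≟ w
  hits? v (colour k) u = col c v u ≟ⁿ k

  Avoids : Fin n → ℕ → Obstacle n → Set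
  Avoids u j (vertex w) = u ≢ w
  Avoids u j (colour k) = j ≢ k

  AvoidsAll : Fin n → ℕ → List (Obstacle n) → Set
  AvoidsAll u j []       = ⊤
  AvoidsAll u j (o ∷ os) = Avoids u j o × AvoidsAll u j os

  -- Each obstacle rules out at most one neighbour of v.
  avoiding-neighbour : ∀ v (obstacles : List (Obstacle n)) → length obstacles < degree G v →
    ∃ λ u → ∃ λ j → Edge v j u × AvoidsAll u j obstacles
  avoiding-neighbour v obstacles lt =
    let u , e , avoid = count-avoid (hits? v) (adj G v) obstacles (single obstacles) lt
    in u , col c v u , (e , refl) , convert avoid
    where
    single : ∀ os → All (λ o → ∀ {u w} → adj G v u ≡ true → adj G v w ≡ true →
                               Hits v o u → Hits v o w → u ≡ w) os
    single []              = []
    single (vertex w ∷ os) = (λ _ _ eq eq′ → trans eq (≡-sym eq′)) ∷ single os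
    single (colour k ∷ os) = (λ e e′ eq eq′ → same-end (e , eq) (e′ , eq′)) ∷ single os
    convert : ∀ {os u} → All (λ o → ¬ Hits v o u) os → AvoidsAll u (col c v u) os
    convert []                      = _
    convert {vertex w ∷ _} (h ∷ hs) = h , convert hs
    convert {colour k ∷ _} (h ∷ hs) = h , convert hs

  -- Consecutive vertices differ by adjacency, and consecutive edges differ in colour by properness,
  -- their outer ends being distinct. This leaves six pairs of vertices and three pairs of colours
  -- as hypotheses.
  rainbow : ∀ {x₁ x₂ x₃ x₄ x₅ k l m o} →
    Edge x₁ k x₂ → Edge x₂ l x₃ → Edge x₃ m x₄ → Edge x₄ o x₅ →
    x₁ ≢ x₃ → x₁ ≢ x₄ → x₁ ≢ x₅ → x₂ ≢ x₄ → x₂ ≢ x₅ → x₃ ≢ x₅ →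
    k ≢ m → k ≢ o → l ≢ o → RainbowP4 G c
  rainbow {x₁} {x₂} {x₃} {x₄} {x₅} {k} {l} {m} {o} e₁ e₂ e₃ e₄ ≢₁₃ ≢₁₄ ≢₁₅ ≢₂₄ ≢₂₅ ≢₃₅ k≢m k≢o l≢o =
    lookup vertices , lookup-injective vertices-unique _ _ , edges ,
    λ {i} {j} eq → lookup-injective colours-unique i j (trans (≡-sym (colour-of i)) (trans eq (colour-of j)))
    where
    vertices : Vec (Fin n) 5
    vertices = x₁ ∷ x₂ ∷ x₃ ∷ x₄ ∷ x₅ ∷ []
    vertices-unique =
      (edge-≢ e₁ ∷ ≢₁₃ ∷ ≢₁₄ ∷ ≢₁₅ ∷ []) ∷ (edge-≢ e₂ ∷ ≢₂₄ ∷ ≢₂₅ ∷ []) ∷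
      (edge-≢ e₃ ∷ ≢₃₅ ∷ []) ∷ (edge-≢ e₄ ∷ []) ∷ [] ∷ []
    colours : Vec ℕ 4
    colours = k ∷ l ∷ m ∷ o ∷ []
    colours-unique =
      (colours-≢ (edge-sym e₁) e₂ ≢₁₃ ∷ k≢m ∷ k≢o ∷ []) ∷
      (colours-≢ (edge-sym e₂) e₃ ≢₂₄ ∷ l≢o ∷ []) ∷
      (colours-≢ (edge-sym e₃) e₄ ≢₃₅ ∷ []) ∷ [] ∷ []
    edges : ∀ i → adj G (lookup vertices (inject₁ i)) (lookup vertices (suc i)) ≡ true
    edges zero                   = proj₁ e₁
    edges (suc zero)             = proj₁ e₂
    edges (suc (suc zero))       = proj₁ e₃
    edges (suc (suc (suc zero))) = proj₁ e₄
    colour-of : ∀ i → col c (lookup vertices (inject₁ i)) (lookup vertices (suc i)) ≡ lookup colours i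
    colour-of zero                   = proj₂ e₁
    colour-of (suc zero)             = proj₂ e₂
    colour-of (suc (suc zero))       = proj₂ e₃
    colour-of (suc (suc (suc zero))) = proj₂ e₄

-- A vertex of degree at least 5 when all degrees are at least 3

module HighDegree {n} (G : Graph n) (c : ProperColouring G) (free : RainbowFree G c)
  (deg≥3 : ∀ u → 3 ≤ degree G u) (v : Fin n) (deg≥5 : 5 ≤ degree G v) where

  open ColouredEdges G c

  module RainbowP3 {w y x k l i} (wy : Edge w k y) (yx : Edge y l x) (xv : Edge x i v)
    (w≢x : w ≢ x) (w≢v : w ≢ v) (y≢v : y ≢ v) (k≢i : k ≢ i) where

    -- Otherwise u v x y w is a rainbow path: j differs from i by properness, and from l and k by
    -- assumption.
    spoke-colour : ∀ {u j} → Edge v j u → u ≢ x → u ≢ y → u ≢ w → j ≢ l → j ≡ k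
    spoke-colour {u} {j} vu u≢x u≢y u≢w j≢l = decidable-stable (j ≟ⁿ k) λ j≢k → free $
      rainbow (edge-sym vu) (edge-sym xv) (edge-sym yx) (edge-sym wy)
        u≢x u≢y u≢w (≢-sym y≢v) (≢-sym w≢v) (≢-sym w≢x) j≢l j≢k (≢-sym k≢i)

    -- If y is not adjacent to v, four obstacles suffice for `spoke-colour`, and one of the five
    -- spokes avoids them all.
    y-spoke : ∃ λ m → Edge v m y
    y-spoke = decidable-stable (adjacent? v y) λ ¬vy →
      let u , j , vu , u≢x , u≢w , j≢k , j≢l , _ =
            avoiding-neighbour v (vertex x ∷ vertex w ∷ colour k ∷ colour l ∷ []) deg≥5
      in j≢k (spoke-colour vu u≢x (≢-sym (not-end vu λ vy → ¬vy (_ , vy))) u≢w j≢l)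

    w-spoke : ∃ λ m → Edge v m w
    w-spoke = decidable-stable (adjacent? v w) λ ¬vw →
      let u , j , vu , u≢x , u≢y , j≢k , j≢l , _ =
            avoiding-neighbour v (vertex x ∷ vertex y ∷ colour k ∷ colour l ∷ []) deg≥5
      in j≢k (spoke-colour vu u≢x u≢y (≢-sym (not-end vu λ vw → ¬vw (_ , vw))) j≢l)

    first-colour-spoke : ∃ λ p → Edge v k p × p ≢ x × p ≢ y × p ≢ w
    first-colour-spoke =
      let p , j , vp , p≢x , p≢y , p≢w , j≢l , _ =
            avoiding-neighbour v (vertex x ∷ vertex y ∷ vertex w ∷ colour l ∷ []) deg≥5
      in p , subst (λ j → Edge v j p) (spoke-colour vp p≢x p≢y p≢w j≢l) vp , p≢x , p≢y , p≢w

    second-colour-spoke : ∃ λ q → Edge v l q × q ≢ x × q ≢ y × q ≢ w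
    second-colour-spoke =
      let q , j , vq , q≢x , q≢y , q≢w , j≢k , _ =
            avoiding-neighbour v (vertex x ∷ vertex y ∷ vertex w ∷ colour k ∷ []) deg≥5
          j≡l = decidable-stable (j ≟ⁿ l) λ j≢l → j≢k (spoke-colour vq q≢x q≢y q≢w j≢l)
      in q , subst (λ j → Edge v j q) j≡l vq , q≢x , q≢y , q≢w

  -- If z were not adjacent to v, a third edge zu of colour other than i would make u z x v a path
  -- with three distinct colours, and `y-spoke` would supply the missing edge.
  neighbourhood-closed : ∀ {x z i l} → Edge v i x → Edge x l z → z ≢ v → ∃ λ m → Edge v m z
  neighbourhood-closed {x} {z} {i} vx xz z≢v = decidable-stable (adjacent? v z) λ ¬vz →
    let u , j , zu , u≢x , j≢i , _ =
          avoiding-neighbour z (vertex x ∷ colour i ∷ []) (deg≥3 z)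
    in ¬vz (RainbowP3.y-spoke (edge-sym zu) (edge-sym xz) (edge-sym vx)
              u≢x (≢-sym (not-end zu λ zv → ¬vz (_ , edge-sym zv))) z≢v j≢i)

  -- In the notation of the header, x₁ … x₅ are x, y, w, q, p.
  record Fan (x₁ x₂ x₃ x₄ x₅ : Fin n) (i₁ i₂ i₃ i₄ i₅ : ℕ) : Set where
    field
      spoke₁ : Edge v i₁ x₁
      spoke₂ : Edge v i₂ x₂
      spoke₃ : Edge v i₃ x₃
      spoke₄ : Edge v i₄ x₄
      spoke₅ : Edge v i₅ x₅
      rim₁₂  : Edge x₁ i₄ x₂
      rim₂₃  : Edge x₂ i₅ x₃
      1≢3    : x₁ ≢ x₃
      4≢1    : x₄ ≢ x₁
      4≢2    : x₄ ≢ x₂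
      4≢3    : x₄ ≢ x₃
      5≢1    : x₅ ≢ x₁
      5≢2    : x₅ ≢ x₂
      5≢3    : x₅ ≢ x₃
      other-spoke : ∀ {u j} → Edge v j u → u ≢ x₁ → u ≢ x₂ → u ≢ x₃ → u ≢ x₄ → u ≢ x₅ → ⊥

  -- Reversing the rim path x₁ x₂ x₃ swaps x₄ with x₅, so whatever is proved about x₄ also holds for
  -- x₅.
  reflect : ∀ {x₁ x₂ x₃ x₄ x₅ i₁ i₂ i₃ i₄ i₅} →
    Fan x₁ x₂ x₃ x₄ x₅ i₁ i₂ i₃ i₄ i₅ → Fan x₃ x₂ x₁ x₅ x₄ i₃ i₂ i₁ i₅ i₄
  reflect F = record
    { spoke₁ = spoke₃ ; spoke₂ = spoke₂ ; spoke₃ = spoke₁ ; spoke₄ = spoke₅ ; spoke₅ = spoke₄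
    ; rim₁₂ = edge-sym rim₂₃ ; rim₂₃ = edge-sym rim₁₂
    ; 1≢3 = ≢-sym 1≢3 ; 4≢1 = 5≢3 ; 4≢2 = 5≢2 ; 4≢3 = 5≢1 ; 5≢1 = 4≢3 ; 5≢2 = 4≢2 ; 5≢3 = 4≢1
    ; other-spoke = λ e ≢₃ ≢₂ ≢₁ ≢₅ ≢₄ → other-spoke e ≢₁ ≢₂ ≢₃ ≢₄ ≢₅ }
    where open Fan F

  module FanEdges {x₁ x₂ x₃ x₄ x₅ i₁ i₂ i₃ i₄ i₅} (F : Fan x₁ x₂ x₃ x₄ x₅ i₁ i₂ i₃ i₄ i₅) where
    open Fan F public

    1≢2 : x₁ ≢ x₂
    1≢2 = edge-≢ rim₁₂

    2≢3 : x₂ ≢ x₃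
    2≢3 = edge-≢ rim₂₃

    i₄≢i₅ : i₄ ≢ i₅
    i₄≢i₅ = colours-≢ (edge-sym rim₁₂) rim₂₃ 1≢3

    4≢5 : x₄ ≢ x₅
    4≢5 refl = i₄≢i₅ (same-colour spoke₄ spoke₅)

    v≢ : ∀ {i x} → Edge v i x → v ≢ x
    v≢ = edge-≢

    ≢v : ∀ {i x} → Edge v i x → x ≢ v
    ≢v e = ≢-sym (edge-≢ e)

    i₄-at-4 : ∀ {k z j} → Edge x₄ k z → Edge v j z → k ≢ i₄
    i₄-at-4 e vz = colours-≢ e (edge-sym spoke₄) (≢v vz)

    -- The path x₄ x₃ v x₁ x₂, coloured k, i₃, i₁, i₄, is rainbow unless k is i₁; in that case x₁ x₂
    -- v x₃ x₄ is rainbow.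
    no-43 : ∀ {k} → Edge x₄ k x₃ → ⊥
    no-43 {k} e with k ≟ⁿ i₁
    ... | no k≢i₁ = free $
      rainbow e (edge-sym spoke₃) spoke₁ rim₁₂
        (≢v spoke₄) 4≢1 4≢2 (≢-sym 1≢3) (≢-sym 2≢3) (v≢ spoke₂)
        k≢i₁ (i₄-at-4 e spoke₃) (colours-≢ spoke₃ spoke₄ (≢-sym 4≢3))
    ... | yes refl = free $
      rainbow rim₁₂ (edge-sym spoke₂) spoke₃ (edge-sym e)
        (≢v spoke₁) 1≢3 (≢-sym 4≢1) 2≢3 (≢-sym 4≢2) (v≢ spoke₄)
        (colours-≢ spoke₄ spoke₃ 4≢3) (≢-sym (i₄-at-4 e spoke₃)) (colours-≢ spoke₂ spoke₁ (≢-sym 1≢2))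

    -- Now x₄ x₅ v x₁ x₂ is rainbow unless k is i₁, and then x₄ x₅ v x₂ x₁ is.
    no-45 : ∀ {k} → Edge x₄ k x₅ → ⊥
    no-45 {k} e with k ≟ⁿ i₁
    ... | no k≢i₁ = free $
      rainbow e (edge-sym spoke₅) spoke₁ rim₁₂
        (≢v spoke₄) 4≢1 4≢2 5≢1 5≢2 (v≢ spoke₂)
        k≢i₁ (i₄-at-4 e spoke₅) (≢-sym i₄≢i₅)
    ... | yes refl = free $
      rainbow e (edge-sym spoke₅) spoke₂ (edge-sym rim₁₂)
        (≢v spoke₄) 4≢2 4≢1 5≢2 5≢1 (v≢ spoke₁)
        (colours-≢ spoke₁ spoke₂ 1≢2) (i₄-at-4 e spoke₅) (≢-sym i₄≢i₅)

    -- By `neighbourhood-closed` and `other-spoke`, z is one of the five spoke ends, of which x₃, x₄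
    -- and x₅ are excluded. As x₄ has degree at least 3, it is therefore adjacent to both x₁ and x₂.
    neighbour-of-4 : ∀ {k z} → Edge x₄ k z → z ≢ v → z ≡ x₁ ⊎ z ≡ x₂
    neighbour-of-4 {k} {z} e z≢v with z ≟ x₁ | z ≟ x₂
    ... | yes eq | _      = inj₁ eq
    ... | no _   | yes eq = inj₂ eq
    ... | no ≢₁  | no ≢₂  = ⊥-elim (other-spoke (proj₂ (neighbourhood-closed spoke₄ e z≢v)) ≢₁ ≢₂
                              (≢-sym (not-end e no-43)) (≢-sym (edge-≢ e)) (≢-sym (not-end e no-45)))

    edge-42 : Edge x₄ i₁ x₂
    edge-42 with avoiding-neighbour x₄ (vertex v ∷ vertex x₁ ∷ []) (deg≥3 x₄)
    ... | z , k , e , z≢v , z≢₁ , _ with neighbour-of-4 e z≢v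
    ... | inj₁ eq   = ⊥-elim (z≢₁ eq)
    ... | inj₂ refl = subst (λ k → Edge x₄ k x₂) k≡i₁ e
      where
      k≡i₁ : k ≡ i₁
      -- For any other colour k the path x₁ v x₄ x₂ x₃, coloured i₁, i₄, k, i₅, is rainbow.
      k≡i₁ = decidable-stable (k ≟ⁿ i₁) λ k≢i₁ → free $
        rainbow (edge-sym spoke₁) spoke₄ e rim₂₃
          (≢-sym 4≢1) 1≢2 1≢3 (v≢ spoke₂) (v≢ spoke₃) 4≢3
          (≢-sym k≢i₁) (colours-≢ spoke₁ spoke₅ (≢-sym 5≢1)) i₄≢i₅

    edge-41 : Edge x₄ i₅ x₁
    edge-41 with avoiding-neighbour x₄ (vertex v ∷ vertex x₂ ∷ []) (deg≥3 x₄)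
    ... | z , k , e , z≢v , z≢₂ , _ with neighbour-of-4 e z≢v
    ... | inj₂ eq   = ⊥-elim (z≢₂ eq)
    ... | inj₁ refl = subst (λ k → Edge x₄ k x₁) k≡i₅ e
      where
      -- If k is not i₅, the path x₄ x₁ v x₃ x₂ forces it to be i₃. But then x₃ x₂ v x₁ x₄, coloured
      -- i₅, i₂, i₁, i₃, is rainbow.
      k≡i₃ : k ≢ i₅ → k ≡ i₃
      k≡i₃ k≢i₅ = decidable-stable (k ≟ⁿ i₃) λ k≢i₃ → free $
        rainbow e (edge-sym spoke₁) spoke₃ (edge-sym rim₂₃)
          (≢v spoke₄) 4≢3 4≢2 1≢3 1≢2 (v≢ spoke₂)
          k≢i₃ k≢i₅ (colours-≢ spoke₁ spoke₅ (≢-sym 5≢1))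
      k≡i₅ : k ≡ i₅
      k≡i₅ = decidable-stable (k ≟ⁿ i₅) λ k≢i₅ → free $
        rainbow (edge-sym rim₂₃) (edge-sym spoke₂) spoke₁ (edge-sym e)
          (≢v spoke₃) (≢-sym 1≢3) (≢-sym 4≢3) (≢-sym 1≢2) (≢-sym 4≢2) (v≢ spoke₄)
          (colours-≢ spoke₅ spoke₁ 5≢1) (≢-sym k≢i₅)
          (λ i₂≡k → colours-≢ spoke₂ spoke₃ 2≢3 (trans i₂≡k (k≡i₃ k≢i₅)))

  -- The edges found at x₄, and by reflection at x₅, form the path x₁ x₄ x₂ x₅ x₃ with colours i₅,
  -- i₁, i₃, i₄.
  no-fan : ∀ {x₁ x₂ x₃ x₄ x₅ i₁ i₂ i₃ i₄ i₅} → ¬ Fan x₁ x₂ x₃ x₄ x₅ i₁ i₂ i₃ i₄ i₅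
  no-fan F = free $
    rainbow (edge-sym L.edge-41) L.edge-42 (edge-sym R.edge-42) R.edge-41
      L.1≢2 (≢-sym L.5≢1) L.1≢3 L.4≢5 L.4≢3 L.2≢3
      (colours-≢ L.spoke₅ L.spoke₃ L.5≢3) (≢-sym L.i₄≢i₅) (colours-≢ L.spoke₁ L.spoke₄ (≢-sym L.4≢1))
    where
    module L = FanEdges F
    module R = FanEdges (reflect F)

  no-rainbow-P3 : ∀ {w y x k l i} → Edge w k y → Edge y l x → Edge x i v →
    w ≢ x → w ≢ v → y ≢ v → k ≢ i → ⊥
  no-rainbow-P3 {w} {y} {x} {k} {l} wy yx xv w≢x w≢v y≢v k≢i = no-fan record
    { spoke₁ = edge-sym xv ; spoke₂ = proj₂ y-spoke ; spoke₃ = proj₂ w-spoke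
    ; spoke₄ = vq ; spoke₅ = vp
    ; rim₁₂ = edge-sym yx ; rim₂₃ = edge-sym wy
    ; 1≢3 = ≢-sym w≢x ; 4≢1 = q≢x ; 4≢2 = q≢y ; 4≢3 = q≢w ; 5≢1 = p≢x ; 5≢2 = p≢y ; 5≢3 = p≢w
    -- A sixth spoke cannot have the colour l of vq, so `spoke-colour` gives it the colour k of vp,
    -- against properness.
    ; other-spoke = λ {u} {j} vu u≢x u≢y u≢w u≢q u≢p →
        colours-≢ vu vp u≢p (spoke-colour vu u≢x u≢y u≢w (colours-≢ vu vq u≢q)) }
    where
    open RainbowP3 wy yx xv w≢x w≢v y≢v k≢i
    p = proj₁ first-colour-spoke
    vp = proj₁ (proj₂ first-colour-spoke)
    p≢x = proj₁ (proj₂ (proj₂ first-colour-spoke))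
    p≢y = proj₁ (proj₂ (proj₂ (proj₂ first-colour-spoke)))
    p≢w = proj₂ (proj₂ (proj₂ (proj₂ first-colour-spoke)))
    q = proj₁ second-colour-spoke
    vq = proj₁ (proj₂ second-colour-spoke)
    q≢x = proj₁ (proj₂ (proj₂ second-colour-spoke))
    q≢y = proj₁ (proj₂ (proj₂ (proj₂ second-colour-spoke)))
    q≢w = proj₂ (proj₂ (proj₂ (proj₂ second-colour-spoke)))

  -- The edges xa and vb are disjoint; if their colours differed, a x b v would be a path with three
  -- distinct colours ending at v.
  opposite-colour : ∀ {i k l x a b} → Edge v i x → Edge x k a → Edge x l b →
    a ≢ v → b ≢ v → a ≢ b → Edge v k b
  opposite-colour {k = k} {b = b} vx xa xb a≢v b≢v a≢b =
    let m , vb = neighbourhood-closed vx xb b≢v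
        m≡k = decidable-stable (m ≟ⁿ k) λ m≢k →
          no-rainbow-P3 (edge-sym xa) xb (edge-sym vb) a≢b a≢v (≢-sym (edge-≢ vx)) (≢-sym m≢k)
    in subst (λ m → Edge v m b) m≡k vb

  impossible : ⊥
  impossible =
    let x , i , vx , _ = avoiding-neighbour v [] (≤-trans (s≤s z≤n) deg≥5)
        y , k , xy , y≢v , _ =
          avoiding-neighbour x (vertex v ∷ []) (≤-trans (s≤s (s≤s z≤n)) (deg≥3 x))
        z , l , xz , z≢v , z≢y , _ =
          avoiding-neighbour x (vertex v ∷ vertex y ∷ []) (deg≥3 x)
        -- The spoke vz takes the colour of xy, and vy that of xz.
        vz = opposite-colour vx xy xz y≢v z≢v (≢-sym z≢y)
        vy = opposite-colour vx xz xy z≢v y≢v z≢y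
        t , j , vt , t≢x , t≢y , t≢z , _ =
          avoiding-neighbour v (vertex x ∷ vertex y ∷ vertex z ∷ [])
            (≤-trans (s≤s (s≤s (s≤s (s≤s z≤n)))) deg≥5)
        x≢v = ≢-sym (edge-≢ vx)
        t≢v = ≢-sym (edge-≢ vt)
        -- An edge from t to x, y or z would give vt the colour of vz or vy.
        ¬tx : ∀ {m} → Edge t m x → ⊥
        ¬tx tx = t≢z (same-end (opposite-colour vx xy (edge-sym tx) y≢v t≢v (≢-sym t≢y)) vz)
        ¬ty : ∀ {m} → Edge t m y → ⊥
        ¬ty ty = t≢z (same-end (opposite-colour vy (edge-sym xy) (edge-sym ty) x≢v t≢v (≢-sym t≢x)) vz)
        ¬tz : ∀ {m} → Edge t m z → ⊥
        ¬tz tz = t≢y (same-end (opposite-colour vz (edge-sym xz) (edge-sym tz) x≢v t≢v (≢-sym t≢x)) vy)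
        s , a , ts , s≢v , _ =
          avoiding-neighbour t (vertex v ∷ []) (≤-trans (s≤s (s≤s z≤n)) (deg≥3 t))
        s′ , b , ts′ , s′≢v , s′≢s , _ =
          avoiding-neighbour t (vertex v ∷ vertex s ∷ []) (deg≥3 t)
        vs′ = opposite-colour vt ts ts′ s≢v s′≢v (≢-sym s′≢s)
    -- The path is y x v t s. Its colours are those of the four spokes vz, vx, vt and vs′, whose
    -- ends are distinct.
    in free $ rainbow (edge-sym xy) (edge-sym vx) vt ts
         y≢v (≢-sym t≢y) (not-end ts ¬ty) (≢-sym t≢x) (not-end ts ¬tx) (≢-sym s≢v)
         (colours-≢ vz vt (≢-sym t≢z))
         (colours-≢ vz vs′ (not-end ts′ ¬tz))
         (colours-≢ vx vs′ (not-end ts′ ¬tx))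

-- Deleting a vertex; the bound on the degree sum

delete : ∀ {n} → Fin (suc n) → Graph (suc n) → Graph n
delete v G = record
  { adj    = λ i j → adj G (punchIn v i) (punchIn v j)
  ; sym    = λ i j → sym G (punchIn v i) (punchIn v j)
  ; irrefl = λ i → irrefl G (punchIn v i) }

delete-colouring : ∀ {n} (v : Fin (suc n)) {G : Graph (suc n)} →
  ProperColouring G → ProperColouring (delete v G)
delete-colouring v c = record
  { col    = λ i j → col c (punchIn v i) (punchIn v j)
  ; colSym = λ i j → colSym c (punchIn v i) (punchIn v j)
  ; proper = λ i j k ij ik j≢k →
      proper c (punchIn v i) (punchIn v j) (punchIn v k) ij ik (j≢k ∘ punchIn-injective v j k) }

delete-rainbowFree : ∀ {n} (v : Fin (suc n)) {G : Graph (suc n)} {c : ProperColouring G} →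
  RainbowFree G c → RainbowFree (delete v G) (delete-colouring v c)
delete-rainbowFree v free (f , f-inj , edges , rainbow) =
  free (punchIn v ∘ f , f-inj ∘ punchIn-injective v _ _ , edges , rainbow)

-- In the adjacency matrix the row and the column of v each contribute `degree G v`, the diagonal
-- entry being zero.
degreeSum-delete : ∀ {n} (v : Fin (suc n)) (G : Graph (suc n)) →
  degreeSum G ≡ degree G v + (degree G v + degreeSum (delete v G))
degreeSum-delete v G = trans (sum-remove {i = v} (degree G)) (cong (degree G v +_) rest)
  where
  open ≡-Reasoning
  to-v : sum (λ i → bit (adj G (punchIn v i) v)) ≡ degree G v
  to-v = begin
    sum (λ i → bit (adj G (punchIn v i) v))                    ≡⟨ sum-cong-≗ (λ i → cong bit (sym G (punchIn v i) v)) ⟩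
    sum (λ i → bit (adj G v (punchIn v i)))                    ≡⟨ cong (λ b → bit b + sum (λ i → bit (adj G v (punchIn v i)))) (irrefl G v) ⟨
    bit (adj G v v) + sum (λ i → bit (adj G v (punchIn v i)))  ≡⟨ sum-remove {i = v} (bit ∘ adj G v) ⟨
    degree G v                                                 ∎
  rest : sum (degree G ∘ punchIn v) ≡ degree G v + degreeSum (delete v G)
  rest = begin
    sum (degree G ∘ punchIn v)
      ≡⟨ sum-cong-≗ (λ i → sum-remove {i = v} (bit ∘ adj G (punchIn v i))) ⟩
    sum (λ i → bit (adj G (punchIn v i) v) + degree (delete v G) i)
      ≡⟨ ∑-distrib-+ (λ i → bit (adj G (punchIn v i) v)) (degree (delete v G)) ⟩
    sum (λ i → bit (adj G (punchIn v i) v)) + degreeSum (delete v G)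
      ≡⟨ cong (_+ degreeSum (delete v G)) to-v ⟩
    degree G v + degreeSum (delete v G)
      ∎

-- In the degree sum every edge counts twice, so a deleted vertex of degree at most 2 costs at most
-- 4, as much as `n * 4` drops.
degreeSum-bound : ∀ {n} (G : Graph n) (c : ProperColouring G) → RainbowFree G c → degreeSum G ≤ n * 4
degreeSum-bound {zero}  G c free = z≤n
degreeSum-bound {suc n} G c free with any? (λ v → degree G v ≤? 2)
... | yes (v , deg≤2) = begin
    degreeSum G                                        ≡⟨ degreeSum-delete v G ⟩
    degree G v + (degree G v + degreeSum (delete v G)) ≤⟨ +-mono-≤ deg≤2 (+-mono-≤ deg≤2
                                                          (degreeSum-bound (delete v G) (delete-colouring v c) (delete-rainbowFree v {c = c} free))) ⟩
    2 + (2 + n * 4)                                    ∎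
  where open ≤-Reasoning
... | no ¬low with any? (λ v → 5 ≤? degree G v)
... | yes (v , deg≥5) =
    ⊥-elim (HighDegree.impossible G c free (λ u → ≰⇒> λ deg≤2 → ¬low (u , deg≤2)) v deg≥5)
... | no ¬high = sum-≤-const 4 λ v → s≤s⁻¹ (≰⇒> λ deg≥5 → ¬high (v , deg≥5))

-- Edge counts as half the degree sum

sum-tabulate : ∀ {n} {A : Set} (h : A → ℕ) (g : Fin n → A) →
  List.sum (map h (tabulate g)) ≡ sum (h ∘ g)
sum-tabulate {zero}  h g = refl
sum-tabulate {suc n} h g = cong (h (g zero) +_) (sum-tabulate h (g ∘ suc))

edgeCount-∑ : ∀ {n} (G : Graph n) →
  edgeCount G ≡ sum λ i → sum λ j → bit ((toℕ i <ᵇ toℕ j) ∧ adj G i j)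
edgeCount-∑ {n} G = trans (sum-tabulate row id) (sum-cong-≗ λ i → sum-tabulate (up i) id)
  where
  up : Fin n → Fin n → ℕ
  up i j = bit ((toℕ i <ᵇ toℕ j) ∧ adj G i j)
  row : Fin n → ℕ
  row i = List.sum (map (up i) (tabulate id))

edgeCount-cong : ∀ {n} {G H : Graph n} → (∀ u v → adj G u v ≡ adj H u v) → edgeCount G ≡ edgeCount H
edgeCount-cong {G = G} {H} G≗H = begin
  edgeCount G
    ≡⟨ edgeCount-∑ G ⟩
  sum (λ i → sum λ j → bit ((toℕ i <ᵇ toℕ j) ∧ adj G i j))
    ≡⟨ sum-cong-≗ (λ i → sum-cong-≗ λ j → cong (λ b → bit ((toℕ i <ᵇ toℕ j) ∧ b)) (G≗H i j)) ⟩
  sum (λ i → sum λ j → bit ((toℕ i <ᵇ toℕ j) ∧ adj H i j))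
    ≡⟨ edgeCount-∑ H ⟨
  edgeCount H
    ∎
  where open ≡-Reasoning

-- Add to the sum over pairs i < j its transpose: by trichotomy each ordered pair of distinct
-- vertices is then counted once, and the diagonal vanishes by irreflexivity.
handshake : ∀ {n} (G : Graph n) → 2 * edgeCount G ≡ degreeSum G
handshake {n} G = begin
  2 * edgeCount G
    ≡⟨ cong (edgeCount G +_) (+-identityʳ _) ⟩
  edgeCount G + edgeCount G
    ≡⟨ cong₂ _+_ (edgeCount-∑ G) (trans (edgeCount-∑ G) (∑-comm up)) ⟩
  sum (λ i → sum (up i)) + sum (λ i → sum λ j → up j i)
    ≡⟨ ∑-distrib-+ (λ i → sum (up i)) (λ i → sum λ j → up j i) ⟨
  sum (λ i → sum (up i) + sum λ j → up j i)
    ≡⟨ sum-cong-≗ (λ i → ∑-distrib-+ (up i) (λ j → up j i)) ⟨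
  sum (λ i → sum λ j → up i j + up j i)
    ≡⟨ sum-cong-≗ (λ i → sum-cong-≗ λ j → up-down i j) ⟩
  degreeSum G
    ∎
  where
  open ≡-Reasoning
  up : Fin n → Fin n → ℕ
  up i j = bit ((toℕ i <ᵇ toℕ j) ∧ adj G i j)
  <ᵇ-true : ∀ {a b} → a < b → (a <ᵇ b) ≡ true
  <ᵇ-true = Equivalence.to T-≡ ∘ <⇒<ᵇ
  <ᵇ-false : ∀ {a b} → ¬ a < b → (a <ᵇ b) ≡ false
  <ᵇ-false a≮b = ¬-not (a≮b ∘ <ᵇ⇒< _ _ ∘ Equivalence.from T-≡)
  up-down : ∀ i j → up i j + up j i ≡ bit (adj G i j)
  up-down i j with <-cmp (toℕ i) (toℕ j)
  ... | tri< i<j _ j≮i rewrite <ᵇ-true i<j | <ᵇ-false j≮i = +-identityʳ _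
  ... | tri> i≮j _ j<i rewrite <ᵇ-false i≮j | <ᵇ-true j<i = cong bit (sym G j i)
  ... | tri≈ i≮j i≡j j≮i rewrite <ᵇ-false i≮j | <ᵇ-false j≮i | toℕ-injective i≡j =
    cong bit (≡-sym (irrefl G j))

achievable-bound : ∀ {n m} → Achievable n m → m ≤ 2 * n
achievable-bound {n} (G , refl , c , free) = *-cancelˡ-≤ 2 (begin
  2 * edgeCount G ≡⟨ handshake G ⟩
  degreeSum G     ≤⟨ degreeSum-bound G c free ⟩
  n * 4           ≡⟨ *-comm n 4 ⟩
  4 * n           ≡⟨ *-assoc 2 2 n ⟩
  2 * (2 * n)     ∎)
  where open ≤-Reasoning

-- Disjoint unions and copies of K₄,₄

sum-↑ : ∀ a {b} (f : Fin (a + b) → ℕ) → sum f ≡ sum (f ∘ (_↑ˡ b)) + sum (f ∘ (a ↑ʳ_))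
sum-↑ zero    f = refl
sum-↑ (suc a) f = trans (cong (f zero +_) (sum-↑ a (f ∘ suc))) (≡-sym (+-assoc (f zero) _ _))

splitAt-injective : ∀ a {b} {u v : Fin (a + b)} → splitAt a u ≡ splitAt a v → u ≡ v
splitAt-injective a {b} {u} {v} eq =
  trans (≡-sym (join-splitAt a b u)) (trans (cong (join a b) eq) (join-splitAt a b v))

module DisjointUnion {a b} (G : Graph a) (H : Graph b) where

  adj⊎ : Fin a ⊎ Fin b → Fin a ⊎ Fin b → Bool
  adj⊎ (inj₁ u) (inj₁ v) = adj G u v
  adj⊎ (inj₂ u) (inj₂ v) = adj H u v
  adj⊎ _        _        = false

  union : Graph (a + b)
  union = record
    { adj    = λ u v → adj⊎ (splitAt a u) (splitAt a v)
    ; sym    = λ u v → sym⊎ (splitAt a u) (splitAt a v)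
    ; irrefl = λ u → irrefl⊎ (splitAt a u) }
    where
    sym⊎ : ∀ x y → adj⊎ x y ≡ adj⊎ y x
    sym⊎ (inj₁ u) (inj₁ v) = sym G u v
    sym⊎ (inj₁ u) (inj₂ v) = refl
    sym⊎ (inj₂ u) (inj₁ v) = refl
    sym⊎ (inj₂ u) (inj₂ v) = sym H u v
    irrefl⊎ : ∀ x → adj⊎ x x ≡ false
    irrefl⊎ (inj₁ u) = irrefl G u
    irrefl⊎ (inj₂ u) = irrefl H u

  degreeSum-union : degreeSum union ≡ degreeSum G + degreeSum H
  degreeSum-union = trans (sum-↑ a (degree union))
    (cong₂ _+_ (sum-cong-≗ degreeˡ) (sum-cong-≗ degreeʳ))
    where
    open ≡-Reasoning
    degreeˡ : ∀ u → degree union (u ↑ˡ b) ≡ degree G u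
    degreeˡ u = begin
      degree union (u ↑ˡ b)
        ≡⟨ sum-↑ a (bit ∘ adj union (u ↑ˡ b)) ⟩
      sum (λ v → bit (adj union (u ↑ˡ b) (v ↑ˡ b))) + sum (λ v → bit (adj union (u ↑ˡ b) (a ↑ʳ v)))
        ≡⟨ cong₂ _+_
             (sum-cong-≗ λ v → cong bit (cong₂ adj⊎ (splitAt-↑ˡ a u b) (splitAt-↑ˡ a v b)))
             (count-none _ λ v → cong₂ adj⊎ (splitAt-↑ˡ a u b) (splitAt-↑ʳ a b v)) ⟩
      degree G u + 0
        ≡⟨ +-identityʳ _ ⟩
      degree G u
        ∎
    degreeʳ : ∀ u → degree union (a ↑ʳ u) ≡ degree H u
    degreeʳ u = begin
      degree union (a ↑ʳ u)
        ≡⟨ sum-↑ a (bit ∘ adj union (a ↑ʳ u)) ⟩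
      sum (λ v → bit (adj union (a ↑ʳ u) (v ↑ˡ b))) + sum (λ v → bit (adj union (a ↑ʳ u) (a ↑ʳ v)))
        ≡⟨ cong₂ _+_
             (count-none _ λ v → cong₂ adj⊎ (splitAt-↑ʳ a b u) (splitAt-↑ˡ a v b))
             (sum-cong-≗ λ v → cong bit (cong₂ adj⊎ (splitAt-↑ʳ a b u) (splitAt-↑ʳ a b v))) ⟩
      degree H u
        ∎

  -- Compared through degree sums, where the order of the vertices that `edgeCount` refers to does
  -- not enter.
  edgeCount-union : edgeCount union ≡ edgeCount G + edgeCount H
  edgeCount-union = *-cancelˡ-≡ _ _ 2 (begin
    2 * edgeCount union               ≡⟨ handshake union ⟩
    degreeSum union                   ≡⟨ degreeSum-union ⟩
    degreeSum G + degreeSum H         ≡⟨ cong₂ _+_ (handshake G) (handshake H) ⟨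
    2 * edgeCount G + 2 * edgeCount H ≡⟨ *-distribˡ-+ 2 (edgeCount G) (edgeCount H) ⟨
    2 * (edgeCount G + edgeCount H)   ∎)
    where open ≡-Reasoning

  module _ (c : ProperColouring G) (d : ProperColouring H) where

    -- Pairs in different parts are never adjacent; their colour is irrelevant.
    col⊎ : Fin a ⊎ Fin b → Fin a ⊎ Fin b → ℕ
    col⊎ (inj₁ u) (inj₁ v) = col c u v
    col⊎ (inj₂ u) (inj₂ v) = col d u v
    col⊎ _        _        = 0

    union-colouring : ProperColouring union
    union-colouring = record
      { col    = λ u v → col⊎ (splitAt a u) (splitAt a v)
      ; colSym = λ u v → colSym⊎ (splitAt a u) (splitAt a v)
      ; proper = λ u v w uv uw v≢w →
          proper⊎ (splitAt a u) (splitAt a v) (splitAt a w) uv uw (v≢w ∘ splitAt-injective a) }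
      where
      colSym⊎ : ∀ x y → col⊎ x y ≡ col⊎ y x
      colSym⊎ (inj₁ u) (inj₁ v) = colSym c u v
      colSym⊎ (inj₁ u) (inj₂ v) = refl
      colSym⊎ (inj₂ u) (inj₁ v) = refl
      colSym⊎ (inj₂ u) (inj₂ v) = colSym d u v
      proper⊎ : ∀ x y z → adj⊎ x y ≡ true → adj⊎ x z ≡ true → y ≢ z → col⊎ x y ≢ col⊎ x z
      proper⊎ (inj₁ u) (inj₁ v) (inj₁ w) uv uw v≢w = proper c u v w uv uw (v≢w ∘ cong inj₁)
      proper⊎ (inj₂ u) (inj₂ v) (inj₂ w) uv uw v≢w = proper d u v w uv uw (v≢w ∘ cong inj₂)

    -- A path is connected, so it stays in the part of its first vertex and is a rainbow path there.
    union-rainbowFree : RainbowFree G c → RainbowFree H d → RainbowFree union union-colouring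
    union-rainbowFree freeG freeH (f , f-inj , edges , rainbow) with splitAt a (f zero) in eq₀
    ... | inj₁ x₀ = freeG
      ( g
      , (λ {i} {j} eq → g-inj i j eq)
      , (λ i → trans (≡-sym (cong₂ adj⊎ (g-eq (inject₁ i)) (g-eq (suc i)))) (edges i))
      , λ {i} {j} eq → rainbow (trans (cong₂ col⊎ (g-eq (inject₁ i)) (g-eq (suc i)))
          (trans eq (≡-sym (cong₂ col⊎ (g-eq (inject₁ j)) (g-eq (suc j)))))) )
      where
      step : ∀ {x y} → adj⊎ x y ≡ true → (∃ λ u → x ≡ inj₁ u) → ∃ λ v → y ≡ inj₁ v
      step {inj₁ _} {inj₁ v} _ _ = v , refl
      step {inj₂ _} _ (_ , ())
      inside : ∀ i → ∃ λ u → splitAt a (f i) ≡ inj₁ u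
      -- Induction along the path: no edge leaves the first part.
      inside = <-weakInduction _ (x₀ , eq₀) λ i → step (edges i)
      g : Fin 5 → Fin a
      g = proj₁ ∘ inside
      g-eq : ∀ i → splitAt a (f i) ≡ inj₁ (g i)
      g-eq = proj₂ ∘ inside
      g-inj : ∀ i j → g i ≡ g j → i ≡ j
      g-inj i j eq = f-inj (splitAt-injective a (trans (g-eq i) (trans (cong inj₁ eq) (≡-sym (g-eq j)))))
    ... | inj₂ x₀ = freeH
      ( g
      , (λ {i} {j} eq → g-inj i j eq)
      , (λ i → trans (≡-sym (cong₂ adj⊎ (g-eq (inject₁ i)) (g-eq (suc i)))) (edges i))
      , λ {i} {j} eq → rainbow (trans (cong₂ col⊎ (g-eq (inject₁ i)) (g-eq (suc i)))
          (trans eq (≡-sym (cong₂ col⊎ (g-eq (inject₁ j)) (g-eq (suc j)))))) )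
      where
      step : ∀ {x y} → adj⊎ x y ≡ true → (∃ λ u → x ≡ inj₂ u) → ∃ λ v → y ≡ inj₂ v
      step {inj₂ _} {inj₂ v} _ _ = v , refl
      step {inj₁ _} _ (_ , ())
      inside : ∀ i → ∃ λ u → splitAt a (f i) ≡ inj₂ u
      inside = <-weakInduction _ (x₀ , eq₀) λ i → step (edges i)
      g : Fin 5 → Fin b
      g = proj₁ ∘ inside
      g-eq : ∀ i → splitAt a (f i) ≡ inj₂ (g i)
      g-eq = proj₂ ∘ inside
      g-inj : ∀ i j → g i ≡ g j → i ≡ j
      g-inj i j eq = f-inj (splitAt-injective a (trans (g-eq i) (trans (cong inj₂ eq) (≡-sym (g-eq j)))))

achievable-+ : ∀ {a b k l} → Achievable a k → Achievable b l → Achievable (a + b) (k + l)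
achievable-+ (G , refl , c , freeG) (H , refl , d , freeH) =
  union , edgeCount-union , union-colouring c d , union-rainbowFree c d freeG freeH
  where open DisjointUnion G H

achievable-empty : ∀ n → Achievable n 0
achievable-empty n = G , no-edges , c , λ (_ , _ , edges , _) → contradiction (edges zero) λ ()
  where
  G : Graph n
  G = record { adj = λ _ _ → false ; sym = λ _ _ → refl ; irrefl = λ _ → refl }
  c : ProperColouring G
  c = record { col = λ _ _ → 0 ; colSym = λ _ _ → refl ; proper = λ _ _ _ () }
  no-edges : edgeCount G ≡ 0
  no-edges = *-cancelˡ-≡ _ _ 2 (trans (handshake G)
    (trans (sum-cong-≗ λ u → count-none (adj G u) λ _ → refl) (sum-replicate-zero n)))

-- The vertices of K₄,₄ are the elements of (ℤ/2)³, in binary; the first bit is the side, and an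
-- edge is coloured by the sum of the remaining bits of its ends. The four colours sum to zero, so
-- a walk using each of them once starts and ends at the same vertex.
module K₄,₄ where

  binary : Fin 8 → Bool × Bool × Bool
  binary u = odd (half (half (toℕ u))) , odd (half (toℕ u)) , odd (toℕ u)
    where
    odd : ℕ → Bool
    odd k = ⌊ k % 2 ≟ⁿ 1 ⌋
    half : ℕ → ℕ
    half k = k / 2

  side : Fin 8 → Bool
  side u = proj₁ (binary u)

  colour-code : Bool × Bool × Bool → Bool × Bool × Bool → ℕ
  colour-code (_ , x , y) (_ , x′ , y′) = 2 * bit (x xor x′) + bit (y xor y′)

  graph : Graph 8
  graph = record
    { adj    = λ u v → side u xor side v
    ; sym    = λ u v → xor-comm (side u) (side v)
    ; irrefl = λ u → xor-same (side u) }

  edge? : ∀ u v → Dec (adj graph u v ≡ true)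
  edge? u v = adj graph u v ≟ᵇ true

  colouring : ProperColouring graph
  colouring = record
    { col    = λ u v → colour-code (binary u) (binary v)
    ; colSym = λ u v → cong₂ (λ x y → 2 * bit x + bit y)
        (xor-comm (proj₁ (proj₂ (binary u))) _) (xor-comm (proj₂ (proj₂ (binary u))) _)
    ; proper = toWitness {a? = all? λ u → all? λ v → all? λ w → edge? u v →-dec edge? u w →-dec
        ¬? (v ≟ w) →-dec ¬? (colour-code (binary u) (binary v) ≟ⁿ colour-code (binary u) (binary w))} _ }

  κ : Fin 8 → Fin 8 → ℕ
  κ = col colouring

  -- Each hypothesis follows directly on the vertices it concerns, so that the evaluated decision
  -- procedure abandons a failing walk early.
  rainbow-walk-closed : ∀ x₁ x₂ → adj graph x₁ x₂ ≡ true → ∀ x₃ → adj graph x₂ x₃ ≡ true →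
    κ x₁ x₂ ≢ κ x₂ x₃ → ∀ x₄ → adj graph x₃ x₄ ≡ true → κ x₁ x₂ ≢ κ x₃ x₄ → κ x₂ x₃ ≢ κ x₃ x₄ →
    ∀ x₅ → adj graph x₄ x₅ ≡ true → κ x₁ x₂ ≢ κ x₄ x₅ → κ x₂ x₃ ≢ κ x₄ x₅ → κ x₃ x₄ ≢ κ x₄ x₅ →
    x₁ ≡ x₅
  rainbow-walk-closed = toWitness {a? =
    all? λ x₁ → all? λ x₂ → edge? x₁ x₂ →-dec all? λ x₃ → edge? x₂ x₃ →-dec
    ¬? (κ x₁ x₂ ≟ⁿ κ x₂ x₃) →-dec all? λ x₄ → edge? x₃ x₄ →-dec
    ¬? (κ x₁ x₂ ≟ⁿ κ x₃ x₄) →-dec ¬? (κ x₂ x₃ ≟ⁿ κ x₃ x₄) →-dec all? λ x₅ → edge? x₄ x₅ →-dec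
    ¬? (κ x₁ x₂ ≟ⁿ κ x₄ x₅) →-dec ¬? (κ x₂ x₃ ≟ⁿ κ x₄ x₅) →-dec ¬? (κ x₃ x₄ ≟ⁿ κ x₄ x₅) →-dec
    (x₁ ≟ x₅)} _

  rainbowFree : RainbowFree graph colouring
  rainbowFree (f , f-inj , edges , rainbow) = contradiction (f-inj closed) λ ()
    where
    distinct : ∀ {i j} → i ≢ j → κ (f (inject₁ i)) (f (suc i)) ≢ κ (f (inject₁ j)) (f (suc j))
    distinct i≢j eq = i≢j (rainbow eq)
    closed : f 0F ≡ f 4F
    closed = rainbow-walk-closed (f 0F) (f 1F) (edges 0F) (f 2F) (edges 1F) (distinct {0F} {1F} λ ())
      (f 3F) (edges 2F) (distinct {0F} {2F} λ ()) (distinct {1F} {2F} λ ())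
      (f 4F) (edges 3F) (distinct {0F} {3F} λ ()) (distinct {1F} {3F} λ ()) (distinct {2F} {3F} λ ())

  achievable : Achievable 8 16
  achievable = graph , refl , colouring , rainbowFree

achievable-blocks : ∀ q r → Achievable (q * 8 + r) (q * 16)
achievable-blocks zero    r = achievable-empty r
achievable-blocks (suc q) r = achievable-+ K₄,₄.achievable (achievable-blocks q r)

-- Decidability of achievability and existence of the maximum

-- All functions are enumerated by number. Decoding the number of f gives a function agreeing with f
-- pointwise, hence the hypothesis that `P` respects pointwise equality.
any-function? : ∀ {m k} {P : (Fin m → Fin k) → Set} →
  (∀ {f g} → (∀ i → f i ≡ g i) → P f → P g) → Decidable P → Dec (∃ P)
any-function? resp P? = map′
  (λ (i , p) → finToFun i , p)
  (λ (f , p) → funToFin f , resp (≡-sym ∘ finToFun-funToFin f) p)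
  (any? (P? ∘ finToFun))

injective? : ∀ {n} {A : Set} → DecidableEquality A → (f : Fin n → A) → Dec (Injective _≡_ _≡_ f)
injective? _≟′_ f = map′ (λ inj {i} {j} → inj i j) (λ inj i j → inj {i} {j})
  (all? λ i → all? λ j → (f i ≟′ f j) →-dec (i ≟ j))

rainbow? : ∀ {n} (G : Graph n) (c : ProperColouring G) → Dec (RainbowP4 G c)
rainbow? G c = any-function?
  (λ {f} {g} f≗g (f-inj , edges , rainbow) →
      (λ {i} {j} eq → f-inj (trans (f≗g i) (trans eq (≡-sym (f≗g j)))))
    , (λ i → trans (≡-sym (cong₂ (adj G) (f≗g (inject₁ i)) (f≗g (suc i)))) (edges i))
    , (λ {i} {j} eq → rainbow (trans (cong₂ (col c) (f≗g (inject₁ i)) (f≗g (suc i)))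
        (trans eq (≡-sym (cong₂ (col c) (f≗g (inject₁ j)) (f≗g (suc j))))))))
  λ f → injective? _≟_ f ×-dec (all? λ i → adj G (f (inject₁ i)) (f (suc i)) ≟ᵇ true)
    ×-dec injective? _≟ⁿ_ (λ i → col c (f (inject₁ i)) (f (suc i)))

-- Read contrapositively, this carries rainbow-freeness from a finer colouring `d` to a coarser `c`,
-- in particular between a colouring and its renaming.
rainbow-refine : ∀ {n} {G : Graph n} (c d : ProperColouring G) →
  (∀ u v u′ v′ → col d u v ≡ col d u′ v′ → col c u v ≡ col c u′ v′) →
  RainbowP4 G c → RainbowP4 G d
rainbow-refine c d finer (f , f-inj , edges , rainbow) = f , f-inj , edges , λ eq → rainbow (finer _ _ _ _ eq)

module ColouringSearch {n} (G : Graph n) where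

  -- Colours range over all of ℕ, but at most `n * n` of them occur, so up to renaming finitely many
  -- colourings remain. The additional value is the default of `rename` for colours that do not
  -- occur.
  Code : Set
  Code = Fin (n * n) → Fin (suc (n * n))

  Encodes : Code → ProperColouring G → Set
  Encodes κ c = ∀ u v → col c u v ≡ toℕ (κ (combine u v))

  -- A used colour is renamed to the position of some pair having it; only the colour
  -- decides which position is found, so equal colours stay equal.
  module Rename (c : ProperColouring G) where

    colour-at : Fin (n * n) → ℕ
    colour-at e = let u , v = remQuot n e in col c u v

    colour-at-combine : ∀ u v → colour-at (combine u v) ≡ col c u v
    colour-at-combine u v = cong (λ (u , v) → col c u v) (remQuot-combine u v)

    rename : ℕ → Fin (suc (n * n))
    rename k with any? (λ e → colour-at e ≟ⁿ k)
    ... | yes (e , _) = suc e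
    ... | no _        = zero

    unrename : Fin (suc (n * n)) → ℕ
    unrename zero    = 0
    unrename (suc e) = colour-at e

    unrename-rename : ∀ u v → unrename (rename (col c u v)) ≡ col c u v
    unrename-rename u v with any? (λ e → colour-at e ≟ⁿ col c u v)
    ... | yes (_ , eq) = eq
    ... | no none      = contradiction (combine u v , colour-at-combine u v) none

    rename-injective : ∀ {u v u′ v′} →
      toℕ (rename (col c u v)) ≡ toℕ (rename (col c u′ v′)) → col c u v ≡ col c u′ v′
    rename-injective {u} {v} {u′} {v′} eq = trans (≡-sym (unrename-rename u v))
      (trans (cong unrename (toℕ-injective eq)) (unrename-rename u′ v′))

    code : Code
    code e = rename (colour-at e)

    renamed : ProperColouring G
    renamed = record
      { col    = λ u v → toℕ (rename (col c u v))
      ; colSym = λ u v → cong (toℕ ∘ rename) (colSym c u v)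
      ; proper = λ u v w uv uw v≢w → proper c u v w uv uw v≢w ∘ rename-injective }

    code-encodes : Encodes code renamed
    code-encodes u v = cong (toℕ ∘ rename) (≡-sym (colour-at-combine u v))

  -- The code fixes every colour, so symmetry and properness are finite checks on `κ`. Colourings
  -- with the same code agree pointwise, so testing the one built from `κ` decides for all.
  encodes-rainbowFree? : ∀ κ → Dec (∃ λ c → Encodes κ c × RainbowFree G c)
  encodes-rainbowFree? κ
    with all? (λ u → all? λ v → K u v ≟ⁿ K v u)
       | all? (λ u → all? λ v → all? λ w → (adj G u v ≟ᵇ true) →-dec (adj G u w ≟ᵇ true) →-dec
           ¬? (v ≟ w) →-dec ¬? (K u v ≟ⁿ K u w))
    where
    K : Fin n → Fin n → ℕ
    K u v = toℕ (κ (combine u v))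
  ... | no ¬s | _ = no λ (c , enc , _) →
        ¬s λ u v → trans (≡-sym (enc u v)) (trans (colSym c u v) (enc v u))
  ... | yes _ | no ¬p = no λ (c , enc , _) →
        ¬p λ u v w uv uw v≢w eq → proper c u v w uv uw v≢w (trans (enc u v) (trans eq (≡-sym (enc u w))))
  ... | yes s | yes p = map′
        (λ free → d , (λ _ _ → refl) , free)
        (λ (c , enc , free) r → free (rainbow-refine d c
          (λ u v u′ v′ eq → trans (≡-sym (enc u v)) (trans eq (enc u′ v′))) r))
        (¬? (rainbow? G d))
    where
    d : ProperColouring G
    d = record { col = λ u v → toℕ (κ (combine u v)) ; colSym = s ; proper = p }

  rainbowFree-colouring? : Dec (∃ λ c → RainbowFree G c)
  rainbowFree-colouring? = map′
    (λ (_ , c , _ , free) → c , free)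
    (λ (c , free) → let open Rename c in
      code , renamed , code-encodes , free ∘ rainbow-refine renamed c (λ _ _ _ _ → cong (toℕ ∘ rename)))
    (any-function?
      (λ κ≗κ′ (c , enc , free) → c , (λ u v → trans (enc u v) (cong toℕ (κ≗κ′ _))) , free)
      encodes-rainbowFree?)

Realises : ∀ {n} → ℕ → Graph n → Set
Realises m G = edgeCount G ≡ m × ∃ λ c → RainbowFree G c

-- Needed because a graph and the one decoded from its code agree only pointwise.
realises-resp : ∀ {n m} {G H : Graph n} → (∀ u v → adj G u v ≡ adj H u v) → Realises m G → Realises m H
realises-resp {G = G} {H} G≗H (eq , c , free) =
  trans (edgeCount-cong {G = H} {G} (λ u v → ≡-sym (G≗H u v))) eq , d ,
  λ (f , f-inj , edges , rainbow) → free (f , f-inj , (λ i → trans (G≗H _ _) (edges i)) , rainbow)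
  where
  d : ProperColouring H
  d = record
    { col    = col c
    ; colSym = colSym c
    ; proper = λ u v w uv uw → proper c u v w (trans (G≗H u v) uv) (trans (G≗H u w) uw) }

module GraphSearch (n m : ℕ) where

  Code : Set
  Code = Fin (n * n) → Fin 2

  toBool : Fin 2 → Bool
  toBool 0F = false
  toBool 1F = true

  fromBool : Bool → Fin 2
  fromBool false = 0F
  fromBool true  = 1F

  toBool-fromBool : ∀ b → toBool (fromBool b) ≡ b
  toBool-fromBool false = refl
  toBool-fromBool true  = refl

  Encodes : Code → Graph n → Set
  Encodes γ G = ∀ u v → adj G u v ≡ toBool (γ (combine u v))

  code : Graph n → Code
  code G e = let u , v = remQuot n e in fromBool (adj G u v)

  code-encodes : ∀ G → Encodes (code G) G
  code-encodes G u v = ≡-sym (trans (toBool-fromBool _)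
    (cong (λ (u , v) → adj G u v) (remQuot-combine u v)))

  encodes-realises? : ∀ γ → Dec (∃ λ G → Encodes γ G × Realises m G)
  encodes-realises? γ
    with all? (λ u → all? λ v → A u v ≟ᵇ A v u) | all? (λ u → A u u ≟ᵇ false)
    where
    A : Fin n → Fin n → Bool
    A u v = toBool (γ (combine u v))
  ... | no ¬s | _ = no λ (G , enc , _) →
        ¬s λ u v → trans (≡-sym (enc u v)) (trans (sym G u v) (enc v u))
  ... | yes _ | no ¬i = no λ (G , enc , _) → ¬i λ u → trans (≡-sym (enc u u)) (irrefl G u)
  ... | yes s | yes i = map′
        (λ r → H , (λ _ _ → refl) , r)
        (λ (G , enc , r) → realises-resp {G = G} {H} enc r)
        ((edgeCount H ≟ⁿ m) ×-dec ColouringSearch.rainbowFree-colouring? H)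
    where
    H : Graph n
    H = record { adj = λ u v → toBool (γ (combine u v)) ; sym = s ; irrefl = i }

  achievable? : Dec (Achievable n m)
  achievable? = map′
    (λ (_ , G , _ , r) → G , r)
    (λ (G , r) → code G , G , code-encodes G , r)
    (any-function?
      (λ γ≗γ′ (G , enc , r) → G , (λ u v → trans (enc u v) (cong toBool (γ≗γ′ _))) , r)
      encodes-realises?)

-- Search downwards from the bound, which drops by one at each failure; at bound zero the given
-- witness is itself maximal.
maximum : ∀ {P : ℕ → Set} → Decidable P → ∀ b → (∀ m → P m → m ≤ b) → ∀ {m₀} → P m₀ →
  ∃ λ m → P m × (∀ m′ → P m′ → m′ ≤ m)
maximum P? zero    bound {m₀} p = m₀ , p , λ m′ p′ → ≤-trans (bound m′ p′) z≤n
maximum P? (suc b) bound p with P? (suc b)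
... | yes top = suc b , top , bound
... | no ¬top = maximum P? b
        (λ m pm → s≤s⁻¹ (≤∧≢⇒< (bound m pm) λ { refl → ¬top pm })) p

theorem11 : (∀ n → 8 ∣ n → IsRainbowTuranP4 n (2 * n)) ×
    (∃[ C ] ∀ n → ∃[ m ] (IsRainbowTuranP4 n m × m ≤ 2 * n + C × 2 * n ≤ m + C))
-- Up to 7 vertices remain outside the blocks of 8, and each accounts for 2 in `2 * n`.
theorem11 = exact , 14 , asymptotic
  where
  twice : ∀ q → q * 16 ≡ 2 * (q * 8)
  twice q = trans (≡-sym (*-assoc q 8 2)) (*-comm (q * 8) 2)

  exact : ∀ n → 8 ∣ n → IsRainbowTuranP4 n (2 * n)
  exact _ (divides q refl) =
    subst₂ Achievable (+-identityʳ (q * 8)) (twice q) (achievable-blocks q 0) ,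
    λ _ → achievable-bound

  asymptotic : ∀ n → ∃[ m ] (IsRainbowTuranP4 n m × m ≤ 2 * n + 14 × 2 * n ≤ m + 14)
  asymptotic n =
    let m , achieved , largest =
          maximum (GraphSearch.achievable? n) (2 * n) (λ _ → achievable-bound) blocks
    in m , (achieved , largest) , ≤-trans (achievable-bound achieved) (m≤m+n (2 * n) 14) ,
       (begin
          2 * n                   ≡⟨ cong (2 *_) division ⟨
          2 * (q * 8 + r)         ≡⟨ *-distribˡ-+ 2 (q * 8) r ⟩
          2 * (q * 8) + 2 * r     ≡⟨ cong (_+ 2 * r) (twice q) ⟨
          q * 16 + 2 * r          ≤⟨ +-mono-≤ (largest _ blocks) (*-monoʳ-≤ 2 (s≤s⁻¹ (m%n<n n 8))) ⟩
          m + 14                  ∎)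
    where
    open ≤-Reasoning
    q = n / 8
    r = n % 8
    division : q * 8 + r ≡ n
    division = trans (+-comm (q * 8) r) (≡-sym (m≡m%n+[m/n]*n n 8))
    blocks : Achievable n (q * 16)
    blocks = subst (λ n → Achievable n (q * 16)) division (achievable-blocks q r)
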